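{- (Soundness) For every set $\Phi\subseteq\mathcal{L}_T$ and every $\alpha\in\mathcal{L}_T$: if $\Phi\vdash\alpha$ in SBTrust, then $\Phi\models\alpha$.
   Context: Propositional formulas: $\varphi::=\bot\mid p\mid\varphi\land\varphi\mid\varphi\lor\varphi\mid\varphi\to\varphi\mid\varphi\leftrightarrow\varphi\mid\neg\varphi$ over a countable set of variables. $\mathcal{L}_T$: $\alpha::=\varphi\mid\varphi\rightsquigarrow\varphi\mid B(\alpha)\mid\alpha*\alpha\mid\neg\alpha$ ($\varphi$ propositional, $*\in\{\land,\lor,\to,\leftrightarrow\}$). SBTrust is the Hilbert system (rule applications must yield formulas of $\mathcal{L}_T$; $\varphi,\psi,\chi,\varphi_i,\psi_i$ propositional; $\alpha,\beta\in\mathcal{L}_T$) with: all classical tautologies over $\mathcal{L}_T$ and Modus Ponens; $\mathbf{ID}$: $\varphi\rightsquigarrow\varphi$; $\mathbf{ST}$: $(\varphi\rightsquigarrow\bot)\to\neg\varphi$; $\mathbf{SH}$: $((\psi\land\chi)\rightsquigarrow\varphi)\to(\psi\rightsquigarrow(\chi\to\varphi))$; $\mathbf{LL+}$: $(\neg(\varphi\leftrightarrow\psi)\rightsquigarrow\bot)\to((\varphi\rightsquigarrow\chi)\leftrightarrow(\psi\rightsquigarrow\chi))$; rule $\mathbf{RCK}$: from $(\varphi_1\land\dots\land\varphi_n)\to\varphi_{n+1}$ infer $((\psi\rightsquigarrow\varphi_1)\land\dots\land(\psi\rightsquigarrow\varphi_n))\to(\psi\rightsquigarrow\varphi_{n+1})$;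 rule $\mathbf{S5_F}$: from $(\ell_1\land\dots\land\ell_n)\to\chi$ infer $(\ell_1\land\dots\land\ell_n)\to(\neg\chi\rightsquigarrow\bot)$, each $\ell_j$ being $\varphi_j\rightsquigarrow\psi_j$ or $\neg(\varphi_j\rightsquigarrow\psi_j)$, $\chi$ propositional; $\mathbf{KB}$: $B(\alpha\to\beta)\to(B(\alpha)\to B(\beta))$; $\mathbf{DB}$: $B(\alpha)\to\neg B(\neg\alpha)$; $\mathbf{4B}$: $B(\alpha)\to B(B(\alpha))$; necessitation for $B$: from $\alpha$ infer $B(\alpha)$. $\Phi\vdash\alpha$ is derivability from assumptions in the usual sense (necessitation applied only to theorems). A Trust model is $\mathcal{M}=\langle S,(S_i)_{i\in I},(\succeq_i)_{i\in I},R,V\rangle$: $R\subseteq S\times S$ serial and transitive; $(S_i)$ a partition of $S$; $\succeq_i\subseteq S_i\times S_i$ arbitrary; $V$ maps variables to subsets of $S$; and for each $i$ and propositional $\varphi$, $\|\varphi\|_i\neq\emptyset\Rightarrow\mathit{most}(\|\varphi\|_i)\neq\emptyset$, with $\|\varphi\|_i=\{v\in S_i:\mathcal{M},v\models\varphi\}$, $\mathit{most}(X)=\{s\in X:\forall v\in X\,(v\succeq_i s\Rightarrow s\succeq_i v)\}$. Truth: $s\models p$ iff $s\in V(p)$; Boolean clauses as usual; $s\models\varphi\rightsquigarrow\psi$ iff $\mathit{most}(\|\varphi\|_i)\subseteq\|\psi\|_i$ where $s\in S_i$; $s\models B(\alpha)$ iff $v\models\alpha$ for every $v$ with $sRv$.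 $\Phi\models\alpha$: in every Trust model, every state satisfying all of $\Phi$ satisfies $\alpha$. -}

module Defs where

open import Data.Bool.Base as Bool using (Bool; true; false)
open import Data.Empty.Polymorphic using (⊥)
open import Data.List.Base using (List; []; _∷_; map)
open import Data.List.Relation.Unary.All using (All)
open import Data.Nat.Base using (ℕ)
open import Data.Product.Base using (∃; _×_; _,_; proj₁)
open import Data.Sum.Base using (_⊎_)
open import Level using (Level; suc; _⊔_)
open import Relation.Binary.Core using (Rel)
open import Relation.Binary.Definitions using (Transitive)
open import Relation.Binary.PropositionalEquality.Core using (_≡_)
open import Relation.Nullary.Negation.Core using (¬_)
open import Relation.Unary using (Pred; _∈_; _⊆_; Satisfiable)

infix  9 ∼_
infixr 7 _∧_
infixr 6 _∨_
infix  5 _↝_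
infixr 4 _⇒_
infix  3 _⇔_

Var : Set
Var = ℕ

data PropForm : Set where
  bot                 : PropForm
  var                 : Var → PropForm
  _∧_ _∨_ _⇒_ _⇔_     : PropForm → PropForm → PropForm
  ∼_                  : PropForm → PropForm

-- The grammar clause α ::= φ is rendered by the function ⌜_⌝ below rather than
-- by a constructor: a Boolean combination of propositional formulas is one and
-- the same formula whether it is built inside PropForm or inside Form.
data Form : Set where
  bot                 : Form
  var                 : Var → Form
  _↝_                 : PropForm → PropForm → Form
  B                   : Form → Form
  _∧_ _∨_ _⇒_ _⇔_     : Form → Form → Form
  ∼_                  : Form → Form

⌜_⌝ : PropForm → Form
⌜ bot ⌝   = bot
⌜ var p ⌝ = var p
⌜ φ ∧ ψ ⌝ = ⌜ φ ⌝ ∧ ⌜ ψ ⌝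
⌜ φ ∨ ψ ⌝ = ⌜ φ ⌝ ∨ ⌜ ψ ⌝
⌜ φ ⇒ ψ ⌝ = ⌜ φ ⌝ ⇒ ⌜ ψ ⌝
⌜ φ ⇔ ψ ⌝ = ⌜ φ ⌝ ⇔ ⌜ ψ ⌝
⌜ ∼ φ ⌝   = ∼ ⌜ φ ⌝

-- The empty conjunction is verum.
⋀ : List Form → Form
⋀ []           = ∼ bot
⋀ (α ∷ [])     = α
⋀ (α ∷ β ∷ αs) = α ∧ ⋀ (β ∷ αs)

-- Only the values of v at variables, conditionals and B-formulas are used:
-- these are the atoms with respect to which tautologies are defined.
eval : (Form → Bool) → Form → Bool
eval v bot         = false
eval v α@(var _)   = v α
eval v α@(_ ↝ _)   = v α
eval v α@(B _)     = v α
eval v (α ∧ β)     = eval v α Bool.∧ eval v β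
eval v (α ∨ β)     = eval v α Bool.∨ eval v β
eval v (α ⇒ β)     = Bool.not (eval v α) Bool.∨ eval v β
eval v (α ⇔ β)     = Bool.not (eval v α Bool.xor eval v β)
eval v (∼ α)       = Bool.not (eval v α)

Tautology : Form → Set
Tautology α = ∀ v → eval v α ≡ true

data Literal : Form → Set where
  pos : ∀ φ ψ → Literal (φ ↝ ψ)
  neg : ∀ φ ψ → Literal (∼ (φ ↝ ψ))

infix 2 ⊢_ _⊢_ _⊨[_]_

data ⊢_ : Form → Set where
  taut : ∀ {α} → Tautology α → ⊢ α
  mp   : ∀ {α β} → ⊢ α ⇒ β → ⊢ α → ⊢ β
  ID   : ∀ φ → ⊢ φ ↝ φ
  ST   : ∀ φ → ⊢ (φ ↝ bot) ⇒ ∼ ⌜ φ ⌝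
  SH   : ∀ φ ψ χ → ⊢ ((ψ ∧ χ) ↝ φ) ⇒ (ψ ↝ (χ ⇒ φ))
  LL+  : ∀ φ ψ χ → ⊢ (∼ (φ ⇔ ψ) ↝ bot) ⇒ ((φ ↝ χ) ⇔ (ψ ↝ χ))
  RCK  : ∀ (φs : List PropForm) φ ψ →
         ⊢ ⋀ (map ⌜_⌝ φs) ⇒ ⌜ φ ⌝ →
         ⊢ ⋀ (map (ψ ↝_) φs) ⇒ (ψ ↝ φ)
  S5F  : ∀ (ls : List Form) χ → All Literal ls →
         ⊢ ⋀ ls ⇒ ⌜ χ ⌝ →
         ⊢ ⋀ ls ⇒ (∼ χ ↝ bot)
  KB   : ∀ α β → ⊢ B (α ⇒ β) ⇒ (B α ⇒ B β)
  DB   : ∀ α → ⊢ B α ⇒ ∼ B (∼ α)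
  4B   : ∀ α → ⊢ B α ⇒ B (B α)
  nec  : ∀ {α} → ⊢ α → ⊢ B α

-- Modus ponens is the only rule applicable below assumptions; RCK, S5F and nec
-- do not preserve truth at a state, only validity, and act on theorems alone.
data _⊢_ {a} (Φ : Pred Form a) : Form → Set a where
  assume : ∀ {α} → α ∈ Φ → Φ ⊢ α
  thm    : ∀ {α} → ⊢ α → Φ ⊢ α
  mp     : ∀ {α β} → Φ ⊢ α ⇒ β → Φ ⊢ α → Φ ⊢ β

-- A Trust model without the condition on most, which refers to truth.
record PreModel ℓ : Set (suc ℓ) where
  field
    S              : Set ℓ
    I              : Set ℓ
    Cell           : I → Pred S ℓ
    _⪰[_]_         : S → I → S → Set ℓ
    R              : Rel S ℓ
    V              : Var → Pred S ℓ
    R-serial       : ∀ s → ∃ λ v → R s v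
    R-transitive   : Transitive R
    Cell-nonempty  : ∀ i → Satisfiable (Cell i)
    Cell-covers    : ∀ s → ∃ λ i → s ∈ Cell i
    Cell-disjoint  : ∀ {i j s} → s ∈ Cell i → s ∈ Cell j → i ≡ j
    ⪰-within-Cell  : ∀ {i u v} → u ⪰[ i ] v → u ∈ Cell i × v ∈ Cell i

  cellOf : S → I
  cellOf s = proj₁ (Cell-covers s)

  most : I → Pred S ℓ → Pred S ℓ
  most i X s = s ∈ X × (∀ v → v ∈ X → v ⪰[ i ] s → s ⪰[ i ] v)

  infix 2 _⊨ₚ_ _⊨_

  _⊨ₚ_ : S → PropForm → Set ℓ
  s ⊨ₚ bot     = ⊥
  s ⊨ₚ var p   = s ∈ V p
  s ⊨ₚ (φ ∧ ψ) = (s ⊨ₚ φ) × (s ⊨ₚ ψ)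
  s ⊨ₚ (φ ∨ ψ) = (s ⊨ₚ φ) ⊎ (s ⊨ₚ ψ)
  s ⊨ₚ (φ ⇒ ψ) = s ⊨ₚ φ → s ⊨ₚ ψ
  s ⊨ₚ (φ ⇔ ψ) = (s ⊨ₚ φ → s ⊨ₚ ψ) × (s ⊨ₚ ψ → s ⊨ₚ φ)
  s ⊨ₚ (∼ φ)   = ¬ (s ⊨ₚ φ)

  ‖_‖ : PropForm → I → Pred S ℓ
  ‖ φ ‖ i v = v ∈ Cell i × (v ⊨ₚ φ)

  -- On the image of ⌜_⌝ this agrees clause by clause with _⊨ₚ_, which is
  -- separate only so that the clause for _↝_ is structurally recursive.
  _⊨_ : S → Form → Set ℓ
  s ⊨ bot     = ⊥
  s ⊨ var p   = s ∈ V p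
  s ⊨ (φ ↝ ψ) = most (cellOf s) (‖ φ ‖ (cellOf s)) ⊆ ‖ ψ ‖ (cellOf s)
  s ⊨ B α     = ∀ v → R s v → v ⊨ α
  s ⊨ (α ∧ β) = (s ⊨ α) × (s ⊨ β)
  s ⊨ (α ∨ β) = (s ⊨ α) ⊎ (s ⊨ β)
  s ⊨ (α ⇒ β) = s ⊨ α → s ⊨ β
  s ⊨ (α ⇔ β) = (s ⊨ α → s ⊨ β) × (s ⊨ β → s ⊨ α)
  s ⊨ (∼ α)   = ¬ (s ⊨ α)

record TrustModel ℓ : Set (suc ℓ) where
  field
    preModel : PreModel ℓ
  open PreModel preModel public
  field
    most-nonempty : ∀ i φ → Satisfiable (‖ φ ‖ i) → Satisfiable (most i (‖ φ ‖ i))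

-- Consequence over all Trust models whose components live in Set ℓ.
_⊨[_]_ : ∀ {a} → Pred Form a → ∀ ℓ → Form → Set (a ⊔ suc ℓ)
Φ ⊨[ ℓ ] α = ∀ (M : TrustModel ℓ) → let open TrustModel M in
             ∀ s → (∀ β → β ∈ Φ → s ⊨ β) → s ⊨ α

{-# OPTIONS --safe #-}
-- Each rule preserves truth at all states of a model.  S5F holds because
-- conditionals have the same truth value throughout a cell; ST and LL+ hold
-- because φ ↝ bot says that φ is true nowhere in the cell, as most of a
-- nonempty truth set is nonempty.
module Submission where

open import Defs
open import Axiom.ExcludedMiddle using (ExcludedMiddle)
open import Relation.Unary using (Pred; _∈_; _⊆_)
open import Data.Bool.Base as Bool using (Bool)
open import Data.Empty using (⊥-elim)
open import Data.List.Base using ([]; _∷_; map)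
open import Data.List.Relation.Unary.All as All using (All; []; _∷_)
open import Data.List.Relation.Unary.All.Properties using (map⁺; map⁻)
open import Data.Product.Base using (_×_; _,_; proj₁; proj₂)
open import Data.Product.Function.NonDependent.Propositional using (_×-⇔_)
open import Data.Sum.Function.Propositional using (_⊎-⇔_)
open import Function.Base using (_∘_)
open import Function.Bundles as Fun using (Equivalence)
open import Function.Properties.Equivalence using (⇔-isEquivalence)
open import Function.Related.TypeIsomorphisms using (→-cong-⇔; ¬-cong-⇔)
open import Relation.Binary.PropositionalEquality.Core using (_≡_; subst)
open import Relation.Binary.Structures using (IsEquivalence)
open import Relation.Nullary.Decidable.Core using (does; proof; decidable-stable)
open import Relation.Nullary.Negation.Core using (¬_)
open import Relation.Nullary.Reflects using (Reflects; ofʸ; ofⁿ; invert; ¬-reflects; _×-reflects_; _⊎-reflects_; _→-reflects_)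

open Equivalence using (to; from)

xnor-reflects : ∀ {p q} {P : Set p} {Q : Set q} {a b} → Reflects P a → Reflects Q b →
                Reflects ((P → Q) × (Q → P)) (Bool.not (a Bool.xor b))
xnor-reflects (ofʸ p)  (ofʸ q)  = ofʸ ((λ _ → q) , (λ _ → p))
xnor-reflects (ofʸ p)  (ofⁿ ¬q) = ofⁿ (λ (f , _) → ¬q (f p))
xnor-reflects (ofⁿ ¬p) (ofʸ q)  = ofⁿ (λ (_ , g) → ¬p (g q))
xnor-reflects (ofⁿ ¬p) (ofⁿ ¬q) = ofʸ (⊥-elim ∘ ¬p , ⊥-elim ∘ ¬q)

module _ {ℓ} (M : TrustModel ℓ) where
  open TrustModel M

  -- Needed because `ST`, `RCK` and `S5F` mention `⌜ φ ⌝`, evaluated by `_⊨_`, while the truth sets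
  -- `‖ φ ‖` are built from `_⊨ₚ_`.
  ⊨⌜⌝⇔⊨ₚ : ∀ {s} φ → (s ⊨ ⌜ φ ⌝) Fun.⇔ (s ⊨ₚ φ)
  ⊨⌜⌝⇔⊨ₚ bot     = IsEquivalence.refl ⇔-isEquivalence
  ⊨⌜⌝⇔⊨ₚ (var p) = IsEquivalence.refl ⇔-isEquivalence
  ⊨⌜⌝⇔⊨ₚ (φ ∧ ψ) = ⊨⌜⌝⇔⊨ₚ φ ×-⇔ ⊨⌜⌝⇔⊨ₚ ψ
  ⊨⌜⌝⇔⊨ₚ (φ ∨ ψ) = ⊨⌜⌝⇔⊨ₚ φ ⊎-⇔ ⊨⌜⌝⇔⊨ₚ ψ
  ⊨⌜⌝⇔⊨ₚ (φ ⇒ ψ) = →-cong-⇔ (⊨⌜⌝⇔⊨ₚ φ) (⊨⌜⌝⇔⊨ₚ ψ)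
  ⊨⌜⌝⇔⊨ₚ (φ ⇔ ψ) = →-cong-⇔ (⊨⌜⌝⇔⊨ₚ φ) (⊨⌜⌝⇔⊨ₚ ψ) ×-⇔ →-cong-⇔ (⊨⌜⌝⇔⊨ₚ ψ) (⊨⌜⌝⇔⊨ₚ φ)
  ⊨⌜⌝⇔⊨ₚ (∼ φ)   = ¬-cong-⇔ (⊨⌜⌝⇔⊨ₚ φ)

  ⋀⁺ : ∀ {s αs} → All (s ⊨_) αs → s ⊨ ⋀ αs
  ⋀⁺ []            = λ ()
  ⋀⁺ (p ∷ [])      = p
  ⋀⁺ (p ∷ q ∷ ps)  = p , ⋀⁺ (q ∷ ps)

  ⋀⁻ : ∀ {s} αs → s ⊨ ⋀ αs → All (s ⊨_) αs
  ⋀⁻ []           _        = []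
  ⋀⁻ (α ∷ [])     p        = p ∷ []
  ⋀⁻ (α ∷ β ∷ αs) (p , ps) = p ∷ ⋀⁻ (β ∷ αs) ps

  ∈cellOf : ∀ s → s ∈ Cell (cellOf s)
  ∈cellOf s = proj₂ (Cell-covers s)

  ↝bot⇒empty : ∀ {s φ} → s ⊨ φ ↝ bot → ∀ {v} → v ∈ Cell (cellOf s) → ¬ (v ⊨ₚ φ)
  ↝bot⇒empty {s} {φ} h v∈C v⊨φ
    with _ , m ← most-nonempty (cellOf s) φ (_ , v∈C , v⊨φ)
    with () ← proj₂ (h m)

  -- Both inclusions are needed: `X` also bounds the quantifier in the maximality condition, so
  -- `most i` is not monotone.
  most-cong : ∀ {i X Y} → X ⊆ Y → Y ⊆ X → most i X ⊆ most i Y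
  most-cong X⊆Y Y⊆X (x∈X , max) = X⊆Y x∈X , λ v → max v ∘ Y⊆X

  -- The truth of a conditional at `s` refers to `s` only through `cellOf s`.
  Literal-cellwise : ∀ {s t l} → Literal l → cellOf s ≡ cellOf t → s ⊨ l → t ⊨ l
  Literal-cellwise (pos φ ψ) eq =
    subst (λ i → most i (‖ φ ‖ i) ⊆ ‖ ψ ‖ i) eq
  Literal-cellwise (neg φ ψ) eq =
    subst (λ i → ¬ (most i (‖ φ ‖ i) ⊆ ‖ ψ ‖ i)) eq

  module _ (em : ExcludedMiddle ℓ) where

    valuation : S → Form → Bool
    valuation s α = does (em {P = s ⊨ α})

    -- By excluded middle, truth at `s` is a Boolean valuation of the atoms, conditionals and
    -- `B`-formulas included; the connectives then agree with their Boolean tables.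
    eval-reflects : ∀ s α → Reflects (s ⊨ α) (eval (valuation s) α)
    eval-reflects s bot       = ofⁿ λ ()
    eval-reflects s (var p)   = proof em
    eval-reflects s (φ ↝ ψ)   = proof em
    eval-reflects s (B α)     = proof em
    eval-reflects s (α ∧ β)   = eval-reflects s α ×-reflects eval-reflects s β
    eval-reflects s (α ∨ β)   = eval-reflects s α ⊎-reflects eval-reflects s β
    eval-reflects s (α ⇒ β)   = eval-reflects s α →-reflects eval-reflects s β
    eval-reflects s (α ⇔ β)   = xnor-reflects (eval-reflects s α) (eval-reflects s β)
    eval-reflects s (∼ α)     = ¬-reflects (eval-reflects s α)

    Tautology⇒⊨ : ∀ α → Tautology α → ∀ s → s ⊨ α
    Tautology⇒⊨ α t s = invert (subst (Reflects (s ⊨ α)) (t (valuation s)) (eval-reflects s α))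

    -- The state is quantified inside the induction: `RCK` and `S5F` use their premise at another
    -- state of the cell, and `nec` at the successors.
    ⊢-sound : ∀ {α} → ⊢ α → ∀ s → s ⊨ α
    ⊢-sound (taut {α} t) s = Tautology⇒⊨ α t s
    ⊢-sound (mp d e) s = ⊢-sound d s (⊢-sound e s)
    ⊢-sound (ID φ) s = proj₁
    ⊢-sound (ST φ) s h s⊨φ = ↝bot⇒empty {φ = φ} h (∈cellOf s) (to (⊨⌜⌝⇔⊨ₚ φ) s⊨φ)
    -- A `most` state of `ψ` that satisfies `χ` is also a `most` state of `ψ ∧ χ`, since it has
    -- fewer competitors there.
    ⊢-sound (SH φ ψ χ) s h ((x∈C , x⊨ψ) , max) =
      x∈C , λ x⊨χ → proj₂ (h ((x∈C , x⊨ψ , x⊨χ) , λ v (v∈C , v⊨ψ , _) → max v (v∈C , v⊨ψ)))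
    ⊢-sound (LL+ φ ψ χ) s h = (λ k → k ∘ most-cong ψ⊆φ φ⊆ψ) , (λ k → k ∘ most-cong φ⊆ψ ψ⊆φ)
      where
      φ⇔ψ : ∀ {v} → v ∈ Cell (cellOf s) → v ⊨ₚ (φ ⇔ ψ)
      -- The hypothesis only refutes `∼ (φ ⇔ ψ)` on the cell; excluded middle removes the double
      -- negation.
      φ⇔ψ v∈C = decidable-stable em (↝bot⇒empty {φ = ∼ (φ ⇔ ψ)} h v∈C)
      φ⊆ψ : ‖ φ ‖ (cellOf s) ⊆ ‖ ψ ‖ (cellOf s)
      φ⊆ψ (v∈C , p) = v∈C , proj₁ (φ⇔ψ v∈C) p
      ψ⊆φ : ‖ ψ ‖ (cellOf s) ⊆ ‖ φ ‖ (cellOf s)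
      ψ⊆φ (v∈C , p) = v∈C , proj₂ (φ⇔ψ v∈C) p
    ⊢-sound (RCK φs φ ψ d) s h {x} m@((x∈C , _) , _) =
      x∈C , to (⊨⌜⌝⇔⊨ₚ φ) (⊢-sound d x (⋀⁺ (map⁺ (All.map
        (λ {φᵢ} k → from (⊨⌜⌝⇔⊨ₚ φᵢ) (proj₂ (k m)))
        (map⁻ (⋀⁻ (map (ψ ↝_) φs) h))))))
    -- The literals carry over from `s` to `x`, a state of the same cell, so the premise yields `χ`
    -- at `x`. Hence no state of the cell satisfies `∼ χ`, and the conditional holds vacuously.
    ⊢-sound (S5F ls χ lits d) s h {x} ((x∈C , x⊭χ) , _) =
      ⊥-elim (x⊭χ (to (⊨⌜⌝⇔⊨ₚ χ) (⊢-sound d x (⋀⁺ (All.zipWith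
        (λ (lit , p) → Literal-cellwise lit (Cell-disjoint x∈C (∈cellOf x)) p)
        (lits , ⋀⁻ ls h))))))
    ⊢-sound (KB α β) s f g v sRv = f v sRv (g v sRv)
    -- Seriality supplies a successor, at which `α` and `∼ α` would both hold.
    ⊢-sound (DB α) s f g with v , sRv ← R-serial s = g v sRv (f v sRv)
    ⊢-sound (4B α) s f v sRv w vRw = f w (R-transitive sRv vRw)
    ⊢-sound (nec d) s v _ = ⊢-sound d v

theorem4 : ∀ {a ℓ} → ExcludedMiddle ℓ → (Φ : Pred Form a) (α : Form) → Φ ⊢ α → Φ ⊨[ ℓ ] α
theorem4 em Φ α (assume α∈Φ) M s hyp = hyp α α∈Φ
theorem4 em Φ α (thm d)      M s hyp = ⊢-sound M em d s
theorem4 em Φ α (mp d e)     M s hyp = theorem4 em Φ _ d M s hyp (theorem4 em Φ _ e M s hyp)
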